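{- Let $\mathcal{G}$ be a hereditary graph class such that $\omega_{\mathcal{G}}:=\max_{H\in\mathcal{G}} mw(H)$ exists. Then for any graph $G$, $mw(G)\le\max(\mathcal{G}\text{ - }mc(G),\ \omega_{\mathcal{G}})$.
   Context: A graph class is a set of graphs containing at least one non-empty graph; it is hereditary if it is closed under taking induced subgraphs. A module of $G$ is a vertex set $M$ such that every vertex outside $M$ is adjacent to all or none of $M$. A $\mathcal{G}$-modular partition of $G$ is a partition of $V(G)$ into modules $M$ with $G[M]\in\mathcal{G}$, and $\mathcal{G}\text{ - }mc(G)$ is the minimum size of such a partition. The modular-width $mw(G)$ is the maximum number of children of a prime node in the modular decomposition tree of $G$ (the inclusion tree of strong modules, where a node for module $M$ is prime if both $G[M]$ and its complement are connected), and $0$ if there is no prime node. -}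

module Defs where

open import Data.Bool.Base using (Bool; false; not; _∧_; T)
open import Data.Bool.Properties using (T?)
open import Data.Empty using (⊥-elim)
open import Data.Fin.Base using (Fin; zero; suc; fromℕ<)
open import Data.Fin.Properties using (_≟_; all?)
open import Data.Fin.Subset using (Subset; inside; outside; _∈_; _∉_; _⊆_; _⊂_; _∩_; ∣_∣; Nonempty; Empty; ⁅_⁆)
open import Data.Fin.Subset.Properties using (_∈?_; _⊆?_; _⊂?_; nonempty?; anySubset?; x∈⁅x⁆; x∈⁅y⁆⇒x≡y; x∈p∩q⁻; ∣⁅x⁆∣≡1)
open import Data.List.Base using (List; []; _∷_; _++_; map; filter; length; allFin)
open import Data.List.Extrema.Nat using (max)
open import Data.List.Membership.Propositional using () renaming (_∈_ to _∈ₗ_)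
open import Data.List.Membership.Propositional.Properties using (∈-allFin)
open import Data.List.Relation.Unary.Any using (here; there)
open import Data.Nat.Base using (ℕ; _≤_; _<_)
open import Data.Nat.Induction using (<-rec)
open import Data.Nat.Properties using (≮⇒≥)
open import Data.Product using (∃; _×_; _,_)
open import Data.Sum using (_⊎_; inj₁; inj₂)
open import Data.Vec.Base using ([]; _∷_)
open import Function.Base using (_∘_)
open import Function.Bundles using (_↔_; Inverse; mk↔ₛ′)
open import Level using (Level)
open import Relation.Binary.Construct.Closure.ReflexiveTransitive using (Star; ε; _◅_; _◅◅_)
open import Relation.Binary.Core using (Rel)
open import Relation.Binary.Definitions using () renaming (Decidable to Decidable₂)
open import Relation.Binary.PropositionalEquality using (_≡_; _≢_; refl; sym; trans; cong; subst)
open import Relation.Nullary using (¬_; Dec; yes; no)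
open import Relation.Nullary.Decidable using (map′; ¬?; _×-dec_; _⊎-dec_; _→-dec_; decidable-stable; isNo)
open import Relation.Unary using (Pred; Decidable)

private
  variable
    ℓ : Level
    n : ℕ

record Graph : Set where
  field
    order      : ℕ
    adj        : Fin order → Fin order → Bool
    adj-sym    : ∀ u v → adj u v ≡ adj v u
    adj-irrefl : ∀ v → adj v v ≡ false

  Vertex : Set
  Vertex = Fin order

  Adj : Rel Vertex _
  Adj u v = T (adj u v)

  Adj? : Decidable₂ Adj
  Adj? u v = T? (adj u v)

open Graph public

record _≅_ (G H : Graph) : Set where
  field
    bijection : Vertex G ↔ Vertex H
    preserves : ∀ u v → adj H (Inverse.to bijection u) (Inverse.to bijection v) ≡ adj G u v

enum : (M : Subset n) → Fin ∣ M ∣ → Fin n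
enum (inside  ∷ M) zero    = zero
enum (inside  ∷ M) (suc i) = suc (enum M i)
enum (outside ∷ M) i       = suc (enum M i)

infix 8 _[_]

_[_] : (G : Graph) → Subset (order G) → Graph
G [ M ] = record
  { order      = ∣ M ∣
  ; adj        = λ i j → adj G (enum M i) (enum M j)
  ; adj-sym    = λ i j → adj-sym G (enum M i) (enum M j)
  ; adj-irrefl = λ i → adj-irrefl G (enum M i)
  }

complement : Graph → Graph
complement G = record
  { order      = order G
  ; adj        = coadj
  ; adj-sym    = coadj-sym
  ; adj-irrefl = coadj-irrefl
  }
  where
  coadj : Vertex G → Vertex G → Bool
  coadj u v = isNo (u ≟ v) ∧ not (adj G u v)

  coadj-sym : ∀ u v → coadj u v ≡ coadj v u
  coadj-sym u v with u ≟ v | v ≟ u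
  ... | yes _   | yes _   = refl
  ... | yes u≡v | no  v≢u = ⊥-elim (v≢u (sym u≡v))
  ... | no  u≢v | yes v≡u = ⊥-elim (u≢v (sym v≡u))
  ... | no  _   | no  _   = cong not (adj-sym G u v)

  coadj-irrefl : ∀ v → coadj v v ≡ false
  coadj-irrefl v with v ≟ v
  ... | yes _   = refl
  ... | no  v≢v = ⊥-elim (v≢v refl)

Connected : Graph → Set
Connected G = ∀ u v → Star (Adj G) u v

-- Star R is decidable for a decidable R on Fin n: `Via ws` is reachability
-- with all intermediate vertices in ws, computed as by Floyd and Warshall.
module _ {R : Rel (Fin n) ℓ} (R? : Decidable₂ R) where
  private
    Via : List (Fin n) → Fin n → Fin n → Set ℓ
    Via []       u v = u ≡ v ⊎ R u v
    Via (w ∷ ws) u v = Via ws u v ⊎ (Via ws u w × Via ws w v)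

    via? : ∀ ws u v → Dec (Via ws u v)
    via? []       u v = (u ≟ v) ⊎-dec R? u v
    via? (w ∷ ws) u v = via? ws u v ⊎-dec (via? ws u w ×-dec via? ws w v)

    sound : ∀ ws {u v} → Via ws u v → Star R u v
    sound []       (inj₁ refl)    = ε
    sound []       (inj₂ r)       = r ◅ ε
    sound (w ∷ ws) (inj₁ p)       = sound ws p
    sound (w ∷ ws) (inj₂ (p , q)) = sound ws p ◅◅ sound ws q

    base : ∀ ws {u v} → u ≡ v ⊎ R u v → Via ws u v
    base []       p = p
    base (w ∷ ws) p = inj₁ (base ws p)

    join : ∀ ws {u j v} → j ∈ₗ ws → Via ws u j → Via ws j v → Via ws u v
    join (w ∷ ws) (here refl) p q = inj₂ (to p , from q)
      where
      to : ∀ {u} → Via (w ∷ ws) u w → Via ws u w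
      to (inj₁ x)       = x
      to (inj₂ (x , _)) = x
      from : ∀ {v} → Via (w ∷ ws) w v → Via ws w v
      from (inj₁ x)       = x
      from (inj₂ (_ , x)) = x
    join (w ∷ ws) (there j∈) (inj₁ p)       (inj₁ q)       = inj₁ (join ws j∈ p q)
    join (w ∷ ws) (there j∈) (inj₁ p)       (inj₂ (q , r)) = inj₂ (join ws j∈ p q , r)
    join (w ∷ ws) (there j∈) (inj₂ (p , q)) (inj₁ r)       = inj₂ (p , join ws j∈ q r)
    join (w ∷ ws) (there j∈) (inj₂ (p , _)) (inj₂ (_ , r)) = inj₂ (p , r)

    complete : ∀ {u v} → Star R u v → Via (allFin n) u v
    complete ε        = base (allFin n) (inj₁ refl)
    complete (r ◅ rs) = join (allFin n) (∈-allFin _) (base (allFin n) (inj₂ r)) (complete rs)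

  star? : Decidable₂ (Star R)
  star? u v = map′ (sound (allFin n)) complete (via? (allFin n) u v)

connected? : Decidable Connected
connected? G = all? λ u → all? λ v → star? (Adj? G) u v

-- Since vertex sets are always of the form Fin n, a set of graphs is a
-- predicate invariant under isomorphism.
record IsGraphClass (𝒢 : Pred Graph ℓ) : Set ℓ where
  field
    resp-≅   : ∀ {G H} → G ≅ H → 𝒢 G → 𝒢 H
    nonempty : ∃ λ H → 0 < order H × 𝒢 H

Hereditary : Pred Graph ℓ → Set ℓ
Hereditary 𝒢 = ∀ G (M : Subset (order G)) → 𝒢 G → 𝒢 (G [ M ])

IsModule : (G : Graph) → Pred (Subset (order G)) _
IsModule G M = ∀ v → v ∉ M → (∀ u → u ∈ M → Adj G v u) ⊎ (∀ u → u ∈ M → ¬ Adj G v u)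

record IsModularPartition (𝒢 : Pred Graph ℓ) (G : Graph) {k : ℕ} (part : Fin k → Subset (order G)) : Set ℓ where
  field
    part-nonempty : ∀ i → Nonempty (part i)
    disjoint      : ∀ i j → i ≢ j → Empty (part i ∩ part j)
    cover         : ∀ v → ∃ λ i → v ∈ part i
    part-module   : ∀ i → IsModule G (part i)
    part-class    : ∀ i → 𝒢 (G [ part i ])

-- k is the minimum size of a 𝒢-modular partition of G.  This is a relation
-- because 𝒢 need not be decidable.
record IsMc (𝒢 : Pred Graph ℓ) (G : Graph) (k : ℕ) : Set ℓ where
  field
    attained : ∃ λ (part : Fin k → Subset (order G)) → IsModularPartition 𝒢 G part
    minimal  : ∀ {m} (part : Fin m → Subset (order G)) → IsModularPartition 𝒢 G part → k ≤ m

-- 𝒢-mc(G) is well defined, classically: a nonempty hereditary class contains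
-- the one-vertex graph, so the singletons form a 𝒢-modular partition.
private
  order1-≅ : ∀ G H → order G ≡ 1 → order H ≡ 1 → G ≅ H
  order1-≅ G@record{} H@record{} refl refl = record
    { bijection = mk↔ₛ′ (λ i → i) (λ i → i) (λ _ → refl) (λ _ → refl)
    ; preserves = λ { zero zero → trans (adj-irrefl H zero) (sym (adj-irrefl G zero)) }
    }

module _ {𝒢 : Pred Graph ℓ} (class : IsGraphClass 𝒢) (hereditary : Hereditary 𝒢) (G : Graph) where
  open IsGraphClass class

  singletons : IsModularPartition 𝒢 G ⁅_⁆
  singletons = record
    { part-nonempty = λ u → u , x∈⁅x⁆ u
    ; disjoint      = λ u v u≢v (x , x∈) → let (x∈u , x∈v) = x∈p∩q⁻ ⁅ u ⁆ ⁅ v ⁆ x∈ in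
                        u≢v (trans (sym (x∈⁅y⁆⇒x≡y u x∈u)) (x∈⁅y⁆⇒x≡y v x∈v))
    ; cover         = λ v → v , x∈⁅x⁆ v
    ; part-module   = isModule
    ; part-class    = inClass
    }
    where
    isModule : ∀ w → IsModule G ⁅ w ⁆
    isModule w v _ with Adj? G v w
    ... | yes a = inj₁ λ u u∈ → subst (Adj G v) (sym (x∈⁅y⁆⇒x≡y w u∈)) a
    ... | no ¬a = inj₂ λ u u∈ → ¬a ∘ subst (Adj G v) (x∈⁅y⁆⇒x≡y w u∈)

    inClass : ∀ u → 𝒢 (G [ ⁅ u ⁆ ])
    inClass u = let (H , 0<∣H∣ , H∈𝒢) = nonempty ; v = fromℕ< 0<∣H∣ in
      resp-≅ (order1-≅ (H [ ⁅ v ⁆ ]) (G [ ⁅ u ⁆ ]) (∣⁅x⁆∣≡1 v) (∣⁅x⁆∣≡1 u)) (hereditary H ⁅ v ⁆ H∈𝒢)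

  mc-exists : ¬ ¬ ∃ (IsMc 𝒢 G)
  mc-exists ¬mc = none (order G) (⁅_⁆ , singletons)
    where
    none : ∀ k → ¬ ∃ λ (part : Fin k → Subset (order G)) → IsModularPartition 𝒢 G part
    none = <-rec _ λ k smaller partition → ¬mc (k , record
      { attained = partition
      ; minimal  = λ part isPart → ≮⇒≥ λ m<k → smaller m<k (part , isPart)
      })

allSubsets : ∀ n → List (Subset n)
allSubsets ℕ.zero    = [] ∷ []
allSubsets (ℕ.suc n) = map (inside ∷_) (allSubsets n) ++ map (outside ∷_) (allSubsets n)

module _ (G : Graph) where
  private
    Set⟨V⟩ = Subset (order G)

  -- Strong modules are taken to be nonempty: they are the nodes of the tree.
  IsStrongModule : Pred Set⟨V⟩ _
  IsStrongModule M = Nonempty M × IsModule G M ×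
    (∀ N → IsModule G N → M ⊆ N ⊎ N ⊆ M ⊎ Empty (M ∩ N))

  -- IsChild M N: N is a child of M in the inclusion tree of strong modules.
  IsChild : Rel Set⟨V⟩ _
  IsChild M N = IsStrongModule M × IsStrongModule N × N ⊂ M ×
    ¬ (∃ λ L → IsStrongModule L × N ⊂ L × L ⊂ M)

  -- Singletons satisfy this condition too, but have no children and so do
  -- not affect the modular-width.
  IsPrimeNode : Pred Set⟨V⟩ _
  IsPrimeNode M = IsStrongModule M × Connected (G [ M ]) × Connected (complement (G [ M ]))

  isModule? : Decidable (IsModule G)
  isModule? M = all? λ v → ¬? (v ∈? M) →-dec
    ((all? λ u → (u ∈? M) →-dec Adj? G v u) ⊎-dec
     (all? λ u → (u ∈? M) →-dec ¬? (Adj? G v u)))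

  isStrongModule? : Decidable IsStrongModule
  isStrongModule? M = nonempty? M ×-dec isModule? M ×-dec
    allSubset? λ N → isModule? N →-dec ((M ⊆? N) ⊎-dec (N ⊆? M) ⊎-dec ¬? (nonempty? (M ∩ N)))
    where
    allSubset? : ∀ {P : Pred Set⟨V⟩ ℓ} → Decidable P → Dec (∀ N → P N)
    allSubset? P? = map′ (λ ¬∃ N → decidable-stable (P? N) λ ¬p → ¬∃ (N , ¬p))
                         (λ ∀P (N , ¬p) → ¬p (∀P N))
                         (¬? (anySubset? (¬? ∘ P?)))

  isChild? : Decidable₂ IsChild
  isChild? M N = isStrongModule? M ×-dec isStrongModule? N ×-dec (N ⊂? M) ×-dec
    ¬? (anySubset? λ L → isStrongModule? L ×-dec (N ⊂? L) ×-dec (L ⊂? M))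

  isPrimeNode? : Decidable IsPrimeNode
  isPrimeNode? M = isStrongModule? M ×-dec connected? (G [ M ]) ×-dec connected? (complement (G [ M ]))

  children : Set⟨V⟩ → List Set⟨V⟩
  children M = filter (isChild? M) (allSubsets (order G))

  primeNodes : List Set⟨V⟩
  primeNodes = filter isPrimeNode? (allSubsets (order G))

  mw : ℕ
  mw = max 0 (map (length ∘ children) primeNodes)

record IsMaxMw (𝒢 : Pred Graph ℓ) (ω : ℕ) : Set ℓ where
  field
    attained : ∃ λ H → 𝒢 H × mw H ≡ ω
    bound    : ∀ H → 𝒢 H → mw H ≤ ω

{-# OPTIONS --safe #-}
module Submission where

-- Let M be a prime node and fix an optimal partition.  As M is strong, either
-- M lies in some part P, or every part meeting M is a proper submodule of M.
-- In the first case the strong modules below M are the same in G and in G[P],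
-- so M is a prime node of G[P] ∈ 𝒢 with the same children, at most ω many.
-- In the second case, since M is prime, every part meeting M lies in a strong
-- module properly contained in M, hence meets only one child of M; choosing a
-- part meeting each child is then an injection from the children to the parts.

open import Defs
open import Data.Bool.Base using (true; false; T)
open import Data.Empty using (⊥-elim)
open import Data.Fin.Base using (Fin; zero; suc)
open import Data.Fin.Properties using (_≟_; any?; injective⇒≤; suc-injective)
open import Data.Fin.Subset using (Subset; inside; outside; _∈_; _∉_; _⊆_; _⊂_; _⊃_; _∩_; _∪_; ∣_∣; Nonempty; Empty)
open import Data.Fin.Subset.Induction using (Acc; acc; ⊃-wellFounded)
open import Data.Fin.Subset.Properties using (_∈?_; _⊆?_; _⊂?_; anySubset?; x∈p∩q⁺; x∈p∩q⁻; x∈p∪q⁺; x∈p∪q⁻; p⊆p∪q; ⊆-antisym)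
open import Data.List.Base using (List; []; _∷_; length; lookup; map; allFin)
open import Data.List.Extrema.Nat using (xs≤max; max≤v⁺)
open import Data.List.Membership.Propositional using () renaming (_∈_ to _∈ₗ_)
open import Data.List.Membership.Propositional.Properties using (∈-allFin; ∈-filter⁺; ∈-filter⁻; ∈-lookup; ∈-map⁺; ∈-map⁻; ∈-++⁺ˡ; ∈-++⁺ʳ)
open import Data.List.Properties using (length-tabulate)
open import Data.List.Relation.Unary.All as All using ()
open import Data.List.Relation.Unary.All.Properties using () renaming (map⁺ to All-map⁺)
open import Data.List.Relation.Unary.AllPairs using ([]; _∷_)
open import Data.List.Relation.Unary.Any using (here; index)
open import Data.List.Relation.Unary.Any.Properties using (lookup-index)
open import Data.List.Relation.Unary.Unique.Propositional using (Unique)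
open import Data.List.Relation.Unary.Unique.Propositional.Properties using (filter⁺; map⁺; ++⁺)
open import Data.Nat.Base using (ℕ; _≤_; _⊔_; z≤n)
open import Data.Nat.Properties using (≤-trans; m≤m⊔n; m≤n⊔m; module ≤-Reasoning)
open import Data.Product using (∃; _×_; _,_; proj₁; proj₂)
open import Data.Sum using (_⊎_; inj₁; inj₂; [_,_])
open import Data.Vec.Base as Vec using ([]; _∷_; here; there)
open import Data.Vec.Properties using (lookup∘tabulate; lookup⇒[]=; []=⇒lookup; ∷-injectiveʳ)
open import Function.Base using (_∘_; id)
open import Level using (Level)
open import Relation.Binary.Construct.Closure.ReflexiveTransitive using (Star; ε; _◅_; gmap)
open import Relation.Binary.PropositionalEquality using (_≡_; _≢_; refl; sym; trans; cong; subst; module ≡-Reasoning)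
open import Relation.Nullary using (¬_; yes; no)
open import Relation.Nullary.Decidable using (¬?; _×-dec_; decidable-stable)
open import Relation.Unary using (Pred)

private
  variable
    a b r ℓ : Level
    A : Set a
    B : Set b
    n : ℕ

-- Counting

lookup-injective : ∀ {xs : List A} → Unique xs → ∀ i j → lookup xs i ≡ lookup xs j → i ≡ j
lookup-injective {xs = _ ∷ _} _        zero    zero    _  = refl
lookup-injective {xs = _ ∷ _} (x∉ ∷ _) zero    (suc j) eq = ⊥-elim (All.lookup x∉ (∈-lookup j) eq)
lookup-injective {xs = _ ∷ _} (x∉ ∷ _) (suc i) zero    eq = ⊥-elim (All.lookup x∉ (∈-lookup i) (sym eq))
lookup-injective {xs = _ ∷ _} (_ ∷ u)  (suc i) (suc j) eq = cong suc (lookup-injective u i j eq)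

-- Each position of `xs` is sent to the position in `ys` of a chosen related element. Equal
-- positions give the same element `y`, so both sources are related to it, hence equal, and
-- uniqueness makes their positions equal. A relation spares callers a function defined on all of
-- `A`.
length-≤-of-injection : ∀ {xs : List A} {ys : List B} (R : A → B → Set r) → Unique xs →
  (∀ {x} → x ∈ₗ xs → ∃ λ y → y ∈ₗ ys × R x y) →
  (∀ {x x′ y} → x ∈ₗ xs → x′ ∈ₗ xs → R x y → R x′ y → x ≡ x′) →
  length xs ≤ length ys
length-≤-of-injection {xs = xs} {ys} R unique image injective =
  injective⇒≤ {f = λ i → index (y∈ i)} λ {i} {j} eq →
    lookup-injective unique i j
      (injective (∈-lookup i) (∈-lookup j) (rel i)
        (subst (R (lookup xs j)) (sym (y-cong i j eq)) (rel j)))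
  where
  y∈  = λ i → proj₁ (proj₂ (image (∈-lookup {xs = xs} i)))
  rel = λ i → proj₂ (proj₂ (image (∈-lookup {xs = xs} i)))

  y-cong : ∀ i j → index (y∈ i) ≡ index (y∈ j) →
    proj₁ (image (∈-lookup {xs = xs} i)) ≡ proj₁ (image (∈-lookup {xs = xs} j))
  y-cong i j eq = trans (lookup-index (y∈ i)) (trans (cong (lookup ys) eq) (sym (lookup-index (y∈ j))))

∈-allSubsets : (M : Subset n) → M ∈ₗ allSubsets n
∈-allSubsets []            = here refl
∈-allSubsets (inside ∷ M)  = ∈-++⁺ˡ (∈-map⁺ (inside ∷_) (∈-allSubsets M))
∈-allSubsets (outside ∷ M) = ∈-++⁺ʳ (map (inside ∷_) (allSubsets _)) (∈-map⁺ (outside ∷_) (∈-allSubsets M))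

-- Makes the lists of children free of repetitions, as the injections out of them require.
allSubsets-unique : ∀ n → Unique (allSubsets n)
allSubsets-unique ℕ.zero    = All.[] ∷ []
allSubsets-unique (ℕ.suc n) =
  ++⁺ (map⁺ ∷-injectiveʳ (allSubsets-unique n)) (map⁺ ∷-injectiveʳ (allSubsets-unique n)) heads-differ
  where
  heads-differ : ∀ {M} → ¬ (M ∈ₗ map (inside ∷_) (allSubsets n) × M ∈ₗ map (outside ∷_) (allSubsets n))
  heads-differ (p , q) with ∈-map⁻ (inside ∷_) p | ∈-map⁻ (outside ∷_) q
  ... | _ , _ , refl | _ , _ , ()

module _ (G : Graph) where

  children-unique : ∀ M → Unique (children G M)
  children-unique M = filter⁺ (isChild? G M) (allSubsets-unique (order G))

  ∈-children⁺ : ∀ {M N} → IsChild G M N → N ∈ₗ children G M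
  ∈-children⁺ {M} {N} = ∈-filter⁺ (isChild? G M) (∈-allSubsets N)

  ∈-children⁻ : ∀ {M N} → N ∈ₗ children G M → IsChild G M N
  ∈-children⁻ {M} = proj₂ ∘ ∈-filter⁻ (isChild? G M) {xs = allSubsets (order G)}

  children≤mw : ∀ {M} → IsPrimeNode G M → length (children G M) ≤ mw G
  children≤mw {M} prime = All.lookup (xs≤max 0 (map (length ∘ children G) (primeNodes G)))
    (∈-map⁺ (length ∘ children G) (∈-filter⁺ (isPrimeNode? G) (∈-allSubsets M) prime))

  mw≤ : ∀ {m} → (∀ M → IsPrimeNode G M → length (children G M) ≤ m) → mw G ≤ m
  -- `z≤n` handles the default value 0 of the maximum, taken when there is no prime node.
  mw≤ bound = max≤v⁺ z≤n (All-map⁺ (All.tabulate λ {M} M∈ →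
    bound M (proj₂ (∈-filter⁻ (isPrimeNode? G) {xs = allSubsets (order G)} M∈))))

-- Induced subgraphs

enum-∈ : (P : Subset n) (i : Fin ∣ P ∣) → enum P i ∈ P
enum-∈ (inside  ∷ P) zero    = here
enum-∈ (inside  ∷ P) (suc i) = there (enum-∈ P i)
enum-∈ (outside ∷ P) i       = there (enum-∈ P i)

enum-injective : (P : Subset n) {i j : Fin ∣ P ∣} → enum P i ≡ enum P j → i ≡ j
enum-injective (inside  ∷ P) {zero}  {zero}  _  = refl
enum-injective (inside  ∷ P) {suc i} {suc j} eq = cong suc (enum-injective P (suc-injective eq))
enum-injective (outside ∷ P)                 eq = enum-injective P (suc-injective eq)

enum⁻¹ : (P : Subset n) {v : Fin n} → v ∈ P → ∃ λ i → enum P i ≡ v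
enum⁻¹ (inside ∷ P)  here      = zero , refl
enum⁻¹ (inside ∷ P)  (there p) = let (i , eq) = enum⁻¹ P p in suc i , cong suc eq
enum⁻¹ (outside ∷ P) (there p) = let (i , eq) = enum⁻¹ P p in i , cong suc eq

-- The trace of `S` on `P`, as a vertex set of the subgraph induced by `P`: the preimage under
-- `enum P`.
restrict : (P : Subset n) → Subset n → Subset ∣ P ∣
restrict P S = Vec.tabulate (λ i → Vec.lookup S (enum P i))

∈-restrict⁺ : ∀ (P : Subset n) {S i} → enum P i ∈ S → i ∈ restrict P S
∈-restrict⁺ P {S} {i} p = lookup⇒[]= i _ (trans (lookup∘tabulate _ i) ([]=⇒lookup p))

∈-restrict⁻ : ∀ (P : Subset n) {S i} → i ∈ restrict P S → enum P i ∈ S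
∈-restrict⁻ P {S} {i} p = lookup⇒[]= _ S (trans (sym (lookup∘tabulate _ i)) ([]=⇒lookup p))

-- The image of `L` under `enum P`. The recursion follows that of `enum`.
extend : (P : Subset n) → Subset ∣ P ∣ → Subset n
extend []            L       = []
extend (inside  ∷ P) (s ∷ L) = s ∷ extend P L
extend (outside ∷ P) L       = outside ∷ extend P L

∈-extend⁺ : ∀ (P : Subset n) {L i} → i ∈ L → enum P i ∈ extend P L
∈-extend⁺ (inside  ∷ P) here      = here
∈-extend⁺ (inside  ∷ P) (there p) = there (∈-extend⁺ P p)
∈-extend⁺ (outside ∷ P) p         = there (∈-extend⁺ P p)

∈-extend⁻ : ∀ (P : Subset n) {L v} → v ∈ extend P L → ∃ λ i → enum P i ≡ v × i ∈ L
∈-extend⁻ (inside  ∷ P) {_ ∷ _} here      = zero , refl , here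
∈-extend⁻ (inside  ∷ P) {_ ∷ _} (there p) = let (i , eq , i∈) = ∈-extend⁻ P p in suc i , cong suc eq , there i∈
∈-extend⁻ (outside ∷ P)         (there p) = let (i , eq , i∈) = ∈-extend⁻ P p in i , cong suc eq , i∈

extend⊆ : ∀ (P : Subset n) {L} → extend P L ⊆ P
extend⊆ P u∈ = let (i , eq , _) = ∈-extend⁻ P u∈ in subst (_∈ P) eq (enum-∈ P i)

enum∈extend⁻ : ∀ (P : Subset n) {L i} → enum P i ∈ extend P L → i ∈ L
enum∈extend⁻ P {L} p = let (j , eq , j∈) = ∈-extend⁻ P p in subst (_∈ L) (enum-injective P eq) j∈

restrict⊆⇒⊆extend : ∀ (P : Subset n) {N L} → N ⊆ P → restrict P N ⊆ L → N ⊆ extend P L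
restrict⊆⇒⊆extend P N⊆P sub v∈N with enum⁻¹ P (N⊆P v∈N)
... | i , refl = ∈-extend⁺ P (sub (∈-restrict⁺ P v∈N))

⊆restrict⇒extend⊆ : ∀ (P : Subset n) {N L} → L ⊆ restrict P N → extend P L ⊆ N
⊆restrict⇒extend⊆ P sub v∈ with ∈-extend⁻ P v∈
... | i , refl , i∈L = ∈-restrict⁻ P (sub i∈L)

-- Connectivity

module _ (G : Graph) where

  coAdj⁺ : ∀ {u v} → u ≢ v → ¬ Adj G u v → Adj (complement G) u v
  coAdj⁺ {u} {v} u≢v ¬a with u ≟ v | adj G u v
  ... | yes u≡v | _     = u≢v u≡v
  ... | no _    | true  = ¬a _
  ... | no _    | false = _

  coAdj⁻ : ∀ {u v} → Adj (complement G) u v → u ≢ v × ¬ Adj G u v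
  coAdj⁻ {u} {v} c with u ≟ v | adj G u v
  ... | no u≢v | false = u≢v , id

  connected-closed : Connected G → (S : Pred (Vertex G) ℓ) →
    (∀ {u v} → Adj G u v → S u → S v) → ∀ {u v} → S u → S v
  connected-closed connected S closed {u} {v} = go (connected u v)
    where
    go : ∀ {u} → Star (Adj G) u v → S u → S v
    go ε        s = s
    go (e ◅ es) s = go es (closed e s)

connected-image : ∀ (G H : Graph) (f : Vertex G → Vertex H) →
  (∀ {u v} → Adj G u v → Adj H (f u) (f v)) → (∀ w → ∃ λ u → f u ≡ w) →
  Connected G → Connected H
connected-image G H f preserves surjective connected w w′ with surjective w | surjective w′
... | u , refl | u′ , refl = gmap f preserves (connected u u′)

-- Modules

module _ (G : Graph) where

  adj-flip : ∀ {u v x y} → adj G u v ≡ adj G x y → adj G v u ≡ adj G y x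
  adj-flip {u} {v} {x} {y} eq = trans (adj-sym G v u) (trans eq (adj-sym G x y))

  -- The Boolean form of the module condition, so that adjacencies can be exchanged in equational
  -- chains.
  module-uniform : ∀ {M} → IsModule G M → ∀ {v x y} → v ∉ M → x ∈ M → y ∈ M → adj G v x ≡ adj G v y
  module-uniform M-mod {v} {x} {y} v∉ x∈ y∈ with M-mod v v∉
  ... | inj₁ all  = both-true  (all x x∈) (all y y∈)
    where
    both-true : ∀ {s t} → T s → T t → s ≡ t
    both-true {true} {true} _ _ = refl
  ... | inj₂ none = both-false (none x x∈) (none y y∈)
    where
    both-false : ∀ {s t} → ¬ T s → ¬ T t → s ≡ t
    both-false {false} {false} _  _  = refl
    both-false {true}          ¬s _  = ⊥-elim (¬s _)
    both-false {false} {true}  _  ¬t = ⊥-elim (¬t _)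

  uniform-module : ∀ {M} z → (∀ {v x} → v ∉ M → x ∈ M → adj G v x ≡ adj G v z) → IsModule G M
  uniform-module z uniform v v∉ with Adj? G v z
  ... | yes a = inj₁ λ x x∈ → subst T (sym (uniform v∉ x∈)) a
  ... | no ¬a = inj₂ λ x x∈ → ¬a ∘ subst T (uniform v∉ x∈)

  -- A vertex outside the union sees every vertex of either module as it sees a common vertex `z`.
  ∪-module : ∀ {M N} → IsModule G M → IsModule G N → Nonempty (M ∩ N) → IsModule G (M ∪ N)
  ∪-module {M} {N} M-mod N-mod (z , z∈) = uniform-module z λ v∉ x∈ →
    [ (λ x∈M → module-uniform M-mod (v∉ ∘ x∈p∪q⁺ ∘ inj₁) x∈M (proj₁ (x∈p∩q⁻ M N z∈)))
    , (λ x∈N → module-uniform N-mod (v∉ ∘ x∈p∪q⁺ ∘ inj₂) x∈N (proj₂ (x∈p∩q⁻ M N z∈)))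
    ] (x∈p∪q⁻ M N x∈)

-- A witness is found by finite search, membership being decidable.
⊈⇒∃ : ∀ {p q : Subset n} → ¬ (p ⊆ q) → ∃ λ x → x ∈ p × x ∉ q
⊈⇒∃ {p = p} {q} p⊈q with any? (λ x → (x ∈? p) ×-dec ¬? (x ∈? q))
... | yes found = found
... | no  none  = ⊥-elim (p⊈q λ {x} x∈p → decidable-stable (x ∈? q) λ x∉q → none (x , x∈p , x∉q))

-- Modules properly contained in a prime node

module _ (G : Graph) {M : Subset (order G)} (prime : IsPrimeNode G M) where
  private
    M-strong    = proj₁ prime
    M-connected = proj₁ (proj₂ prime)
    M-coconn    = proj₂ (proj₂ prime)

  -- The adjacency between Q and M ∖ Q cannot be constant: it would have to be
  -- true by connectedness of G[M] and false by connectedness of its complement.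
  prime-no-uniform-cut : ∀ {Q} → Nonempty Q → Q ⊂ M → ∀ s →
    ¬ (∀ {x y} → x ∈ Q → y ∈ M → y ∉ Q → adj G x y ≡ s)
  prime-no-uniform-cut {Q} (q , q∈Q) (Q⊆M , y , y∈M , y∉Q) s uniform
    with enum⁻¹ M (Q⊆M q∈Q) | enum⁻¹ M y∈M
  ... | i , refl | j , refl = y∉Q (spread s uniform)
    where
    S : Pred (Fin ∣ M ∣) _
    S i = enum M i ∈ Q

    spread : ∀ s → (∀ {x y} → x ∈ Q → y ∈ M → y ∉ Q → adj G x y ≡ s) → S j
    spread false uniform = connected-closed (G [ M ]) M-connected S
      (λ {u} {v} e u∈ → decidable-stable (enum M v ∈? Q) λ v∉ →
        subst T (uniform u∈ (enum-∈ M v) v∉) e) q∈Q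
    spread true uniform = connected-closed (complement (G [ M ])) M-coconn S
      (λ {u} {v} e u∈ → decidable-stable (enum M v ∈? Q) λ v∉ →
        proj₂ (coAdj⁻ (G [ M ]) e) (subst T (sym (uniform u∈ (enum-∈ M v) v∉)) _)) q∈Q

  -- Since `M` is strong, only a module `K` inside `M` could overlap `Q`. By maximality such a `K`
  -- would satisfy Q ∪ K = M, which makes the adjacency between `Q` and the rest of `M` constant and
  -- contradicts primality.
  maximal⇒strong : ∀ {Q} → Nonempty Q → IsModule G Q → Q ⊂ M →
    ¬ (∃ λ K → IsModule G K × Q ⊂ K × K ⊂ M) → IsStrongModule G Q
  maximal⇒strong {Q} Q≠∅ Q-mod Q⊂M@(Q⊆M , _) maximal = Q≠∅ , Q-mod , compare
    where
    no-overlap : ∀ K → IsModule G K → K ⊆ M → ¬ (Q ⊆ K) → ¬ (K ⊆ Q) → ¬ Nonempty (Q ∩ K)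
    no-overlap K K-mod K⊆M Q⊈K K⊈Q meet@(x , x∈) with ⊈⇒∃ Q⊈K | ⊈⇒∃ K⊈Q
    ... | z , z∈Q , z∉K | w , w∈K , w∉Q =
      -- The constant is the adjacency of `z`, in `Q` but not in `K`, to `x`, in both. First `p` is
      -- replaced by `z` within the module `Q`, then `y` by `x` within the module `K`.
      prime-no-uniform-cut Q≠∅ Q⊂M (adj G z x) λ {p} {y} p∈Q y∈M y∉Q → let open ≡-Reasoning in begin
        adj G p y  ≡⟨ adj-flip G (module-uniform G Q-mod y∉Q p∈Q z∈Q) ⟩
        adj G z y  ≡⟨ module-uniform G K-mod z∉K (M∖Q⊆K y∈M y∉Q) (proj₂ (x∈p∩q⁻ Q K x∈)) ⟩
        adj G z x  ∎
      where
      Q∪K⊆M : Q ∪ K ⊆ M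
      Q∪K⊆M p = [ Q⊆M , K⊆M ] (x∈p∪q⁻ Q K p)

      M∖Q⊆K : ∀ {y} → y ∈ M → y ∉ Q → y ∈ K
      M∖Q⊆K {y} y∈M y∉Q = decidable-stable (y ∈? K) λ y∉K →
        -- Otherwise Q ∪ K would be a module strictly between `Q` and `M`: `w` separates it from
        -- `Q`, and `y` separates it from `M`.
        maximal (Q ∪ K , ∪-module G Q-mod K-mod meet
          , (p⊆p∪q K , w , x∈p∪q⁺ (inj₂ w∈K) , w∉Q)
          , Q∪K⊆M , y , y∈M , [ y∉Q , y∉K ] ∘ x∈p∪q⁻ Q K)

    compare : ∀ K → IsModule G K → Q ⊆ K ⊎ K ⊆ Q ⊎ Empty (Q ∩ K)
    compare K K-mod with proj₂ (proj₂ M-strong) K K-mod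
    ... | inj₁ M⊆K              = inj₁ (M⊆K ∘ Q⊆M)
    ... | inj₂ (inj₂ disjoint)  = inj₂ (inj₂ λ (x , x∈) →
      let (x∈Q , x∈K) = x∈p∩q⁻ Q K x∈ in disjoint (x , x∈p∩q⁺ (Q⊆M x∈Q , x∈K)))
    ... | inj₂ (inj₁ K⊆M) with Q ⊆? K | K ⊆? Q
    ...   | yes Q⊆K | _       = inj₁ Q⊆K
    ...   | no  _   | yes K⊆Q = inj₂ (inj₁ K⊆Q)
    ...   | no  Q⊈K | no  K⊈Q = inj₂ (inj₂ (no-overlap K K-mod K⊆M Q⊈K K⊈Q))

  -- Enlarge `Q` until no module lies strictly between it and `M`; the result is strong by
  -- `maximal⇒strong`. Finiteness makes the search decidable and the enlargement terminate.
  strong-above : ∀ {Q} → Nonempty Q → IsModule G Q → Q ⊂ M →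
    ∃ λ L → IsStrongModule G L × Q ⊆ L × L ⊂ M
  strong-above = go (⊃-wellFounded _)
    where
    go : ∀ {Q} → Acc _⊃_ Q → Nonempty Q → IsModule G Q → Q ⊂ M →
      ∃ λ L → IsStrongModule G L × Q ⊆ L × L ⊂ M
    go {Q} (acc larger) Q≠∅@(q , q∈) Q-mod Q⊂M
      with anySubset? (λ K → isModule? G K ×-dec (Q ⊂? K) ×-dec (K ⊂? M))
    ... | no maximal = Q , maximal⇒strong Q≠∅ Q-mod Q⊂M maximal , id , Q⊂M
    ... | yes (K , K-mod , Q⊂K , K⊂M) =
      let (L , L-strong , K⊆L , L⊂M) = go (larger Q⊂K) (q , proj₁ Q⊂K q∈) K-mod K⊂M
      in L , L-strong , K⊆L ∘ proj₁ Q⊂K , L⊂M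

  -- A strong module `L` with Q ⊆ L ⊂ M meets the child `N`, so the two are nested, and `L` cannot
  -- lie strictly between `N` and `M`.
  meeting-child⇒⊆ : ∀ {Q N v} → IsModule G Q → Q ⊂ M → IsChild G M N → v ∈ N → v ∈ Q → Q ⊆ N
  meeting-child⇒⊆ {Q} {N} {v} Q-mod Q⊂M (_ , (_ , _ , N-compare) , _ , maximal) v∈N v∈Q
    with strong-above (v , v∈Q) Q-mod Q⊂M
  ... | L , L-strong , Q⊆L , L⊂M with N-compare L (proj₁ (proj₂ L-strong))
  ...   | inj₂ (inj₁ L⊆N)      = L⊆N ∘ Q⊆L
  ...   | inj₂ (inj₂ disjoint) = ⊥-elim (disjoint (v , x∈p∩q⁺ (v∈N , Q⊆L v∈Q)))
  ...   | inj₁ N⊆L             = λ x∈Q → decidable-stable (_ ∈? N) λ x∉N →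
    maximal (L , L-strong , (N⊆L , _ , Q⊆L x∈Q , x∉N) , L⊂M)

-- Disjointness of distinct children

child⊆child⇒≡ : ∀ (G : Graph) {M N N′} → IsChild G M N → IsChild G M N′ → N ⊆ N′ → N ≡ N′
child⊆child⇒≡ G {N = N} (_ , _ , _ , maximal) (_ , N′-strong , N′⊂M , _) N⊆N′ =
  ⊆-antisym N⊆N′ λ {x} x∈N′ → decidable-stable (x ∈? N) λ x∉N →
    maximal (_ , N′-strong , (N⊆N′ , x , x∈N′ , x∉N) , N′⊂M)

-- Strong modules that meet are nested, and a child properly inside another would not be maximal
-- below `M`.
children-meet⇒≡ : ∀ (G : Graph) {M N N′ v} → IsChild G M N → IsChild G M N′ → v ∈ N → v ∈ N′ → N ≡ N′
children-meet⇒≡ G N-child@(_ , (_ , _ , compare) , _) N′-child@(_ , (_ , N′-mod , _) , _) v∈N v∈N′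
  with compare _ N′-mod
... | inj₁ N⊆N′             = child⊆child⇒≡ G N-child N′-child N⊆N′
... | inj₂ (inj₁ N′⊆N)      = sym (child⊆child⇒≡ G N′-child N-child N′⊆N)
... | inj₂ (inj₂ disjoint)  = ⊥-elim (disjoint (_ , x∈p∩q⁺ (v∈N , v∈N′)))

-- The modular decomposition below a strong module M contained in a module P

module _ (G : Graph) {P : Subset (order G)} (P-mod : IsModule G P) where
  private
    H = G [ P ]

  restrict-module : ∀ {K} → IsModule G K → IsModule H (restrict P K)
  restrict-module K-mod v v∉ with K-mod (enum P v) (v∉ ∘ ∈-restrict⁺ P)
  ... | inj₁ all  = inj₁ λ u u∈ → all (enum P u) (∈-restrict⁻ P u∈)
  ... | inj₂ none = inj₂ λ u u∈ → none (enum P u) (∈-restrict⁻ P u∈)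

  -- A module of a module is a module: a vertex outside `P` sees all of `P` alike, and one inside
  -- `P` is handled in `G [ P ]`.
  extend-module : ∀ {L} → IsModule H L → IsModule G (extend P L)
  extend-module {L} L-mod v v∉ with v ∈? P
  ... | no v∉P with P-mod v v∉P
  ...   | inj₁ all  = inj₁ λ u u∈ → all u (extend⊆ P u∈)
  ...   | inj₂ none = inj₂ λ u u∈ → none u (extend⊆ P u∈)
  extend-module {L} L-mod v v∉ | yes v∈P with enum⁻¹ P v∈P
  ... | i , refl with L-mod i (v∉ ∘ ∈-extend⁺ P)
  ...   | inj₁ all  = inj₁ λ u u∈ → let (j , eq , j∈) = ∈-extend⁻ P u∈ in subst (Adj G _) eq (all j j∈)
  ...   | inj₂ none = inj₂ λ u u∈ → let (j , eq , j∈) = ∈-extend⁻ P u∈ in none j j∈ ∘ subst (Adj G _) (sym eq)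

  -- Any module of `H` that `restrict P N` is compared with extends to a module of `G`, where `N` is
  -- strong.
  restrict-strong : ∀ {N} → IsStrongModule G N → N ⊆ P → IsStrongModule H (restrict P N)
  restrict-strong {N} ((x , x∈N) , N-mod , compare) N⊆P = nonempty , restrict-module N-mod , compare′
    where
    nonempty : Nonempty (restrict P N)
    nonempty with enum⁻¹ P (N⊆P x∈N)
    ... | i , refl = i , ∈-restrict⁺ P x∈N

    compare′ : ∀ L → IsModule H L → restrict P N ⊆ L ⊎ L ⊆ restrict P N ⊎ Empty (restrict P N ∩ L)
    compare′ L L-mod with compare (extend P L) (extend-module L-mod)
    ... | inj₁ N⊆             = inj₁ λ i∈ → enum∈extend⁻ P (N⊆ (∈-restrict⁻ P i∈))
    ... | inj₂ (inj₁ ⊆N)      = inj₂ (inj₁ λ i∈ → ∈-restrict⁺ P (⊆N (∈-extend⁺ P i∈)))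
    ... | inj₂ (inj₂ disjoint) = inj₂ (inj₂ λ (i , i∈) → let (i∈N , i∈L) = x∈p∩q⁻ _ L i∈ in
      disjoint (enum P i , x∈p∩q⁺ (∈-restrict⁻ P i∈N , ∈-extend⁺ P i∈L)))

  module _ {M : Subset (order G)} (M-strong : IsStrongModule G M) (M⊆P : M ⊆ P) where

    -- A module of G need not be comparable with P; strength of M is what confines
    -- the modules that could overlap L to subsets of P.
    extend-strong : ∀ {L} → IsStrongModule H L → L ⊆ restrict P M → IsStrongModule G (extend P L)
    extend-strong {L} ((i , i∈L) , L-mod , compare) L⊆M =
      (enum P i , ∈-extend⁺ P i∈L) , extend-module L-mod , compare′
      where
      L′⊆M : extend P L ⊆ M
      L′⊆M = ⊆restrict⇒extend⊆ P L⊆M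

      compare′ : ∀ K → IsModule G K → extend P L ⊆ K ⊎ K ⊆ extend P L ⊎ Empty (extend P L ∩ K)
      compare′ K K-mod with proj₂ (proj₂ M-strong) K K-mod
      ... | inj₁ M⊆K             = inj₁ (M⊆K ∘ L′⊆M)
      ... | inj₂ (inj₂ disjoint) = inj₂ (inj₂ λ (x , x∈) → let (x∈L , x∈K) = x∈p∩q⁻ _ K x∈ in
        disjoint (x , x∈p∩q⁺ (L′⊆M x∈L , x∈K)))
      ... | inj₂ (inj₁ K⊆M) with compare (restrict P K) (restrict-module K-mod)
      ...   | inj₁ L⊆K             = inj₁ (⊆restrict⇒extend⊆ P L⊆K)
      ...   | inj₂ (inj₁ K⊆L)      = inj₂ (inj₁ (restrict⊆⇒⊆extend P (M⊆P ∘ K⊆M) K⊆L))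
      ...   | inj₂ (inj₂ disjoint) = inj₂ (inj₂ λ (x , x∈) → apart (x∈p∩q⁻ _ K x∈))
        where
        apart : ∀ {x} → ¬ (x ∈ extend P L × x ∈ K)
        apart (x∈L , x∈K) with ∈-extend⁻ P x∈L
        ... | j , refl , j∈L = disjoint (j , x∈p∩q⁺ (j∈L , ∈-restrict⁺ P x∈K))

    -- A strong module of `H` strictly between the two traces would extend to one of `G` strictly
    -- between `N` and `M`.
    restrict-child : ∀ {N} → IsChild G M N → IsChild H (restrict P M) (restrict P N)
    restrict-child {N} (_ , N-strong , (N⊆M , x , x∈M , x∉N) , maximal) =
      restrict-strong M-strong M⊆P , restrict-strong N-strong (M⊆P ∘ N⊆M) , proper , maximal′
      where
      proper : restrict P N ⊂ restrict P M
      proper with enum⁻¹ P (M⊆P x∈M)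
      ... | i , refl = (λ i∈ → ∈-restrict⁺ P (N⊆M (∈-restrict⁻ P i∈)))
                     , i , ∈-restrict⁺ P x∈M , x∉N ∘ ∈-restrict⁻ P

      maximal′ : ¬ (∃ λ L → IsStrongModule H L × restrict P N ⊂ L × L ⊂ restrict P M)
      maximal′ (L , L-strong , (N⊆L , y , y∈L , y∉N) , (L⊆M , z , z∈M , z∉L)) = maximal
        ( extend P L , extend-strong L-strong L⊆M
        , (restrict⊆⇒⊆extend P (M⊆P ∘ N⊆M) N⊆L , enum P y , ∈-extend⁺ P y∈L , y∉N ∘ ∈-restrict⁺ P)
        , (⊆restrict⇒extend⊆ P L⊆M , enum P z , ∈-restrict⁻ P z∈M , z∉L ∘ enum∈extend⁻ P) )

    -- `G [ M ]` and `H [ R ]` are the same graph up to numbering: `M` is enumerated directly in one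
    -- and through `P` in the other. The map `f` matches positions of the same vertex of `G`.
    restrict-connected : Connected (G [ M ]) → Connected (complement (G [ M ])) →
      Connected (H [ restrict P M ]) × Connected (complement (H [ restrict P M ]))
    restrict-connected connected coconnected =
        connected-image (G [ M ]) (H [ R ]) f (subst T (sym (f-adj _ _))) f-surjective connected
      , connected-image (complement (G [ M ])) (complement (H [ R ])) f f-coadj f-surjective coconnected
      where
      R = restrict P M

      position : ∀ {v} → v ∈ M → ∃ λ i → enum P (enum R i) ≡ v
      position v∈M with enum⁻¹ P (M⊆P v∈M)
      ... | j , refl with enum⁻¹ R (∈-restrict⁺ P v∈M)
      ...   | i , refl = i , refl

      f : Vertex (G [ M ]) → Vertex (H [ R ])
      f u = proj₁ (position (enum-∈ M u))

      f-enum : ∀ u → enum P (enum R (f u)) ≡ enum M u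
      f-enum u = proj₂ (position (enum-∈ M u))

      f-adj : ∀ u v → adj (H [ R ]) (f u) (f v) ≡ adj (G [ M ]) u v
      f-adj u v rewrite f-enum u | f-enum v = refl

      f-injective : ∀ {u v} → f u ≡ f v → u ≡ v
      f-injective {u} {v} eq = enum-injective M
        (trans (sym (f-enum u)) (trans (cong (enum P ∘ enum R) eq) (f-enum v)))

      f-coadj : ∀ {u v} → Adj (complement (G [ M ])) u v → Adj (complement (H [ R ])) (f u) (f v)
      f-coadj {u} {v} e = let (u≢v , ¬a) = coAdj⁻ (G [ M ]) e in
        coAdj⁺ (H [ R ]) (u≢v ∘ f-injective) (¬a ∘ subst T (f-adj u v))

      f-surjective : ∀ w → ∃ λ u → f u ≡ w
      f-surjective w = let (u , eq) = enum⁻¹ M (∈-restrict⁻ P (enum-∈ R w)) in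
        u , enum-injective R (enum-injective P (trans (f-enum u) eq))

    restrict-prime : IsPrimeNode G M → IsPrimeNode H (restrict P M)
    restrict-prime (_ , connected , coconnected) =
      restrict-strong M-strong M⊆P , restrict-connected connected coconnected

    -- Restriction sends children of `M` to children of its trace. It is injective on them, because
    -- a child lies in `P` and is therefore determined by its trace.
    children≤mw-induced : IsPrimeNode G M → length (children G M) ≤ mw H
    children≤mw-induced prime = ≤-trans
      (length-≤-of-injection (λ N L → L ≡ restrict P N) (children-unique G M)
        (λ N∈ → _ , ∈-children⁺ H (restrict-child (∈-children⁻ G N∈)) , refl)
        (λ N∈ N′∈ eq eq′ → let same = trans (sym eq) eq′ in
          ⊆-antisym (sub N∈ same) (sub N′∈ (sym same))))
      (children≤mw H (restrict-prime prime))
      where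
      sub : ∀ {N N′} → N ∈ₗ children G M → restrict P N ≡ restrict P N′ → N ⊆ N′
      sub N∈ eq v∈N with enum⁻¹ P (M⊆P (proj₁ (proj₁ (proj₂ (proj₂ (∈-children⁻ G N∈)))) v∈N))
      ... | i , refl = ∈-restrict⁻ P (subst (i ∈_) eq (∈-restrict⁺ P v∈N))

-- Prime nodes contained in no part

children≤parts : ∀ {𝒢 : Pred Graph ℓ} (G : Graph) {k} {part : Fin k → Subset (order G)} →
  IsModularPartition 𝒢 G part → ∀ {M} → IsPrimeNode G M → ¬ (∃ λ i → M ⊆ part i) →
  length (children G M) ≤ k
children≤parts G {k} {part} partition {M} prime M⊈part =
  subst (length (children G M) ≤_) (length-tabulate {n = k} id)
    (length-≤-of-injection (λ N i → ∃ λ v → v ∈ N × v ∈ part i) (children-unique G M) image injective)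
  where
  open IsModularPartition partition

  image : ∀ {N} → N ∈ₗ children G M → ∃ λ i → i ∈ₗ allFin k × ∃ λ v → v ∈ N × v ∈ part i
  image N∈ = let (_ , ((v , v∈N) , _) , _) = ∈-children⁻ G N∈ ; (i , v∈i) = cover v in
    -- The part assigned to a child is the one covering a vertex of it, which exists because strong
    -- modules are nonempty.
    i , ∈-allFin i , v , v∈N , v∈i

  part⊂M : ∀ {i v} → v ∈ M → v ∈ part i → part i ⊂ M
  part⊂M {i} v∈M v∈i with proj₂ (proj₂ (proj₁ prime)) (part i) (part-module i)
  ... | inj₁ M⊆i             = ⊥-elim (M⊈part (i , M⊆i))
  ... | inj₂ (inj₁ i⊆M)      = i⊆M , ⊈⇒∃ (λ M⊆i → M⊈part (i , M⊆i))
  ... | inj₂ (inj₂ disjoint) = ⊥-elim (disjoint (_ , x∈p∩q⁺ (v∈M , v∈i)))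

  part⊆child : ∀ {N i v} → IsChild G M N → v ∈ N → v ∈ part i → part i ⊆ N
  part⊆child N-child@(_ , _ , (N⊆M , _) , _) v∈N v∈i =
    meeting-child⇒⊆ G prime (part-module _) (part⊂M (N⊆M v∈N) v∈i) N-child v∈N v∈i

  injective : ∀ {N N′ i} → N ∈ₗ children G M → N′ ∈ₗ children G M →
    (∃ λ v → v ∈ N × v ∈ part i) → (∃ λ v → v ∈ N′ × v ∈ part i) → N ≡ N′
  injective N∈ N′∈ (v , v∈N , v∈i) (w , w∈N′ , w∈i) =
    let N-child = ∈-children⁻ G N∈ ; N′-child = ∈-children⁻ G N′∈ in
    -- The part meets `N′`, hence lies inside it, so its vertex `v` in `N` belongs to both children.
    children-meet⇒≡ G N-child N′-child v∈N (part⊆child N′-child w∈N′ w∈i v∈i)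

theorem5 : {ℓ : Level} (𝒢 : Pred Graph ℓ) → IsGraphClass 𝒢 → Hereditary 𝒢 →
    (ω : ℕ) → IsMaxMw 𝒢 ω →
    (G : Graph) (k : ℕ) → IsMc 𝒢 G k →
    mw G ≤ k ⊔ ω
theorem5 𝒢 _ _ ω isMax G k isMc = mw≤ G bound
  where
  part      = proj₁ (IsMc.attained isMc)
  partition = proj₂ (IsMc.attained isMc)
  open IsModularPartition partition

  bound : ∀ M → IsPrimeNode G M → length (children G M) ≤ k ⊔ ω
  bound M prime with any? (λ i → M ⊆? part i)
  ... | no M⊈part = ≤-trans (children≤parts G partition prime M⊈part) (m≤m⊔n k ω)
  ... | yes (i , M⊆i) = let open ≤-Reasoning in begin
    length (children G M)  ≤⟨ children≤mw-induced G (part-module i) (proj₁ prime) M⊆i prime ⟩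
    mw (G [ part i ])      ≤⟨ IsMaxMw.bound isMax (G [ part i ]) (part-class i) ⟩
    ω                      ≤⟨ m≤n⊔m k ω ⟩
    k ⊔ ω                  ∎
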